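{- Let $\varphi$ be a DBI normal formula and let $\theta$ be a formula that is independent of $\varphi$. Then for every pointed Kripke model $(\mathcal{M},v)$: $\mathcal{M},v\vDash\theta$ if and only if $\mathcal{M}\odot\mathcal{U}_\varphi,(v,0)\vDash\theta$.
   Context: Agents $\mathcal{A}=\{1,\dots,n\}$, $n>1$; language $\mathcal{L}$: $\varphi ::= p \mid \neg\varphi \mid (\varphi\wedge\varphi)\mid B_i\varphi$, $\top$ the usual tautology. Kripke model $\mathcal{M}=\langle S,R,V\rangle$ (nonempty $S$, $R_i\subseteq S\times S$, $V:\mathit{Prop}\to 2^S$), standard truth. Action model $\mathcal{U}=\langle E,Q,\mathsf{pre}\rangle$ (nonempty $E$, $Q_i\subseteq E\times E$, $\mathsf{pre}:E\to\mathcal{L}$). Pointed update of $(\mathcal{M},w)$ with $(\mathcal{U},\alpha)$, defined iff $\mathcal{M},w\vDash\mathsf{pre}(\alpha)$: with $T=\{(x,\beta)\in S\times E\mid\mathcal{M},x\vDash\mathsf{pre}(\beta)\}$, $\mathcal{M}\odot\mathcal{U}=\langle S^{\mathcal U},R^{\mathcal U},V^{\mathcal U}\rangle$ where $S^{\mathcal U}$ is the smallest subset of $T$ containing $(w,\alpha)$ closed under: $(x,\beta)\in S^{\mathcal U}$, $(u,\gamma)\in T$, $xR_iu$, $\beta Q_i\gamma$ imply $(u,\gamma)\in S^{\mathcal U}$; $R^{\mathcal U}_i$ relates $(x,\beta),(u,\gamma)\in S^{\mathcal U}$ iff $xR_iu$ and $\beta Q_i\gamma$; $V^{\mathcal U}(p)=\{(x,\beta)\in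 S^{\mathcal U}\mid x\in V(p)\}$. Target agents: $\mathsf{ta}(p)=\varnothing$, $\mathsf{ta}(\neg\phi)=\mathsf{ta}(\phi)$, $\mathsf{ta}(\phi\wedge\psi)=\mathsf{ta}(\phi)\cup\mathsf{ta}(\psi)$, $\mathsf{ta}(B_i\phi)=\{i\}$. DBI formulas: $\varphi ::= B_i\xi \mid B_i(\xi\wedge\varphi)\mid(\varphi\wedge\varphi)\mid B_i\varphi$, $\xi$ purely propositional. DBI normal: $B_i\xi$ always; $B_i\varphi$, $B_i(\xi\wedge\varphi)$ iff $\varphi$ DBI normal and $i\notin\mathsf{ta}(\varphi)$; $\varphi\wedge\psi$ iff both DBI normal and $\mathsf{ta}(\varphi)\cap\mathsf{ta}(\psi)=\varnothing$. Action model $\mathcal{U}_\varphi=\langle E^\varphi,Q^\varphi,\mathsf{pre}^\varphi\rangle$ for DBI normal $\varphi$, recursively; always $E^\varphi=\{0,-1\}\sqcup D^\varphi$, $\varnothing\ne D^\varphi\subseteq\{1,2,\dots\}$, $\mathsf{pre}^\varphi(0)=\mathsf{pre}^\varphi(-1)=\top$; $\underline{Q}_j$ denotes $Q_j\cap((E\setminus\{0\})\times(E\setminus\{0\}))$. (1) $\varphi=B_i\xi$: $D=\{m\}$, $\mathsf{pre}(m)=\xi$, $Q_j=\{(0,-1),(m,-1),(-1,-1)\}$ ($j\ne i$), $Q_i=\{(0,m),(m,m),(-1,-1)\}$. (2) $\varphi=B_i\psi$: fresh $m\ge1$, $m\notin D^\psi$; $D^\varphi=D^\psi\sqcup\{m\}$;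 $\mathsf{pre}^\varphi$ extends $\mathsf{pre}^\psi$ with $\mathsf{pre}^\varphi(m)=\top$; $Q^\varphi_j=\underline{Q}^\psi_j\cup\{(0,-1)\}\cup\{(m,k)\mid(0,k)\in Q^\psi_j\}$ ($j\ne i$); $Q^\varphi_i=\underline{Q}^\psi_i\cup\{(0,m),(m,m)\}$. (3) $\varphi=B_i(\xi\wedge\psi)$: as (2) but $\mathsf{pre}^\varphi(m)=\xi$. (4) $\varphi=\psi\wedge\theta$: with $D^\psi\cap D^\theta=\varnothing$, $D^\varphi=D^\psi\sqcup D^\theta$, $\mathsf{pre}^\varphi=\mathsf{pre}^\psi\cup\mathsf{pre}^\theta$, $Q^\varphi_j=\underline{Q}^\psi_j\cup\underline{Q}^\theta_j\cup\{(0,k)\mid(0,k)\in Q^\psi_j\cup Q^\theta_j, k\in D^\psi\sqcup D^\theta\}\cup\{(0,-1)\mid\text{no such }k\text{ exists}\}$. In $\mathcal{U}_\varphi$ every event has exactly one $Q^\varphi_j$-successor for each agent $j$. Independence: the modality sequences of a formula $\theta$ are the empty sequence together with, for each occurrence of a subformula $B_i\eta$ in $\theta$, the sequence $B_{i_1}\dots B_{i_k}$ of belief operators on the path from the root of the syntax tree of $\theta$ to that occurrence (so $i_k=i$). $\theta$ is in $\top$-shape w.r.t. event $\alpha_0\in E^\varphi$ iff for every modality sequence $B_{i_1}\dots B_{i_k}$ of $\theta$ ($k\ge0$), the unique events $\alpha_1,\dots,\alpha_k$ with $\alpha_0Q^\varphi_{i_1}\alpha_1Q^\varphi_{i_2}\alpha_2\cdots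 Q^\varphi_{i_k}\alpha_k$ satisfy $\mathsf{pre}^\varphi(\alpha_j)=\top$ for all $0\le j\le k$. $\theta$ is independent of $\varphi$ iff it is in $\top$-shape w.r.t. $0$. -}

module Defs where

open import Data.Bool.Base using (if_then_else_)
open import Data.Fin.Base using (Fin)
open import Data.Fin.Properties using (_≟_)
open import Data.Fin.Subset as Subset using (Subset; ⁅_⁆)
open import Data.Integer.Base using (ℤ; 0ℤ; 1ℤ; -1ℤ; _≤_)
open import Data.Irrelevant using ([_])
open import Data.List.Base using (List; []; _∷_)
open import Data.List.Relation.Unary.All using (All)
open import Data.Nat.Base using (ℕ)
open import Data.Product.Base using (∃; _×_; _,_; proj₁)
open import Data.Refinement using (Refinement-syntax; value)
open import Data.Sum.Base using (inj₁; inj₂)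
open import Level using (Level; 0ℓ) renaming (suc to lsuc)
open import Relation.Binary.Core using (Rel)
open import Relation.Binary.PropositionalEquality.Core using (_≡_; refl)
open import Relation.Nullary using (¬_; does)
open import Relation.Unary using (Pred; _∈_; _∉_; ｛_｝; _∪_; _∩_; _∖_; _⟨×⟩_; _⊥_)

-- The atom p₀ only serves to write down the tautology ⊤′.
module DEL (n : ℕ) (Atom : Set) (p₀ : Atom) where

  Agent : Set
  Agent = Fin n

  infixr 8 ¬′_
  infixr 7 _∧′_

  data Formula : Set where
    atom : Atom → Formula
    ¬′_  : Formula → Formula
    _∧′_ : Formula → Formula → Formula
    B    : Agent → Formula → Formula

  ⊤′ : Formula
  ⊤′ = ¬′ (atom p₀ ∧′ ¬′ atom p₀)

  record KripkeModel (ℓ : Level) : Set (lsuc ℓ) where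
    field
      S        : Set ℓ
      nonempty : S
      R        : Agent → Rel S ℓ
      V        : Atom → Pred S ℓ

  record ActionModel : Set₁ where
    field
      E        : Set
      nonempty : E
      Q        : Agent → Rel E 0ℓ
      pre      : E → Formula

  open KripkeModel using (S; R; V)
  open ActionModel using (E; Q; pre)

  private variable
    ℓ : Level

  infix 4 _,_⊨_
  _,_⊨_ : (M : KripkeModel ℓ) → S M → Formula → Set ℓ
  M , w ⊨ atom p = w ∈ V M p
  M , w ⊨ ¬′ φ   = ¬ (M , w ⊨ φ)
  M , w ⊨ φ ∧′ ψ = (M , w ⊨ φ) × (M , w ⊨ ψ)
  M , w ⊨ B i φ  = ∀ u → R M i w u → M , u ⊨ φ

  ⊨⊤′ : (M : KripkeModel ℓ) (w : S M) → M , w ⊨ ⊤′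
  ⊨⊤′ M w (p , ¬p) = ¬p p

  -- The update of (M , w) with (U , α); it exists only given a proof of
  -- M , w ⊨ pre U α.
  module Update (M : KripkeModel ℓ) (U : ActionModel) (w : S M) (α : E U)
                (w⊨pre : M , w ⊨ pre U α) where

    T : Pred (S M × E U) ℓ
    T (x , β) = M , x ⊨ pre U β

    data Sᵁ : Pred (S M × E U) ℓ where
      start : (w , α) ∈ Sᵁ
      step  : ∀ {x β u γ i} → (x , β) ∈ Sᵁ → (u , γ) ∈ T →
              R M i x u → Q U i β γ → (u , γ) ∈ Sᵁ

    -- Membership in Sᵁ is proof-irrelevant here, so that the worlds form a
    -- subset of S M × E U, with no duplicates for different derivations.
    World : Set ℓ
    World = [ xβ ∈ S M × E U ∣ xβ ∈ Sᵁ ]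

    origin : World
    origin = record { value = w , α ; proof = [ start ] }

    model : KripkeModel ℓ
    model = record
      { S        = World
      ; nonempty = origin
      ; R        = λ i s t → let (x , β) = value s ; (u , γ) = value t in
                                R M i x u × Q U i β γ
      ; V        = λ p s → proj₁ (value s) ∈ V M p
      }

  ta : Formula → Subset n
  ta (atom p) = Subset.⊥
  ta (¬′ φ)   = ta φ
  ta (φ ∧′ ψ) = ta φ Subset.∪ ta ψ
  ta (B i φ)  = ⁅ i ⁆

  data Propositional : Formula → Set where
    atom : ∀ p → Propositional (atom p)
    ¬′_  : ∀ {ξ} → Propositional ξ → Propositional (¬′ ξ)
    _∧′_ : ∀ {ξ ζ} → Propositional ξ → Propositional ζ → Propositional (ξ ∧′ ζ)

  private variable
    φ ψ ξ : Formula

  data DBI : Formula → Set where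
    Bξ   : ∀ i → Propositional ξ → DBI (B i ξ)
    Bφ   : ∀ i → DBI φ → DBI (B i φ)
    Bξ∧φ : ∀ i → Propositional ξ → DBI φ → DBI (B i (ξ ∧′ φ))
    _∧′_ : DBI φ → DBI ψ → DBI (φ ∧′ ψ)

  data Normal : DBI φ → Set where
    Bξ   : ∀ i (πξ : Propositional ξ) → Normal (Bξ i πξ)
    Bφ   : ∀ i {dφ : DBI φ} → Normal dφ → i Subset.∉ ta φ → Normal (Bφ i dφ)
    Bξ∧φ : ∀ i (πξ : Propositional ξ) {dφ : DBI φ} → Normal dφ →
           i Subset.∉ ta φ → Normal (Bξ∧φ i πξ dφ)
    _∧′_⟨_⟩ : {dφ : DBI φ} {dψ : DBI ψ} → Normal dφ → Normal dψ →
              ta φ Subset.∩ ta ψ ≡ Subset.⊥ → Normal (dφ ∧′ dψ)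

  private variable
    i : Agent

  -- The action model of a DBI normal formula depends on the choice of the
  -- fresh events. An element of Events nφ is one admissible choice, and D c
  -- is the resulting set of positive events.
  data Events : {dφ : DBI φ} → Normal dφ → Set
  D : {dφ : DBI φ} {nφ : Normal dφ} → Events nφ → Pred ℤ 0ℓ

  data Events where
    Bξ   : {πξ : Propositional ξ} (m : ℤ) → 1ℤ ≤ m → Events (Bξ i πξ)
    Bφ   : {dφ : DBI φ} {nφ : Normal dφ} {i∉ : i Subset.∉ ta φ}
           (c : Events nφ) (m : ℤ) → 1ℤ ≤ m → m ∉ D c → Events (Bφ i nφ i∉)
    Bξ∧φ : {πξ : Propositional ξ} {dφ : DBI φ} {nφ : Normal dφ} {i∉ : i Subset.∉ ta φ}
           (c : Events nφ) (m : ℤ) → 1ℤ ≤ m → m ∉ D c → Events (Bξ∧φ i πξ nφ i∉)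
    _∧′_⟨_⟩ : {dφ : DBI φ} {dψ : DBI ψ} {nφ : Normal dφ} {nψ : Normal dψ}
              {dis : ta φ Subset.∩ ta ψ ≡ Subset.⊥}
              (c : Events nφ) (c′ : Events nψ) → D c ⊥ D c′ →
              Events (nφ ∧′ nψ ⟨ dis ⟩)

  D (Bξ m _)          = ｛ m ｝
  D (Bφ c m _ _)      = D c ∪ ｛ m ｝
  D (Bξ∧φ c m _ _)    = D c ∪ ｛ m ｝
  D (c ∧′ c′ ⟨ _ ⟩)   = D c ∪ D c′

  Eᵠ : {dφ : DBI φ} {nφ : Normal dφ} → Events nφ → Pred ℤ 0ℓ
  Eᵠ c = ｛ 0ℤ ｝ ∪ ｛ -1ℤ ｝ ∪ D c

  preD : {dφ : DBI φ} {nφ : Normal dφ} (c : Events nφ) → ∀ {e} → e ∈ D c → Formula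
  preD (Bξ {ξ = ξ} _ _)       _        = ξ
  preD (Bφ c _ _ _)           (inj₁ e) = preD c e
  preD (Bφ _ _ _ _)           (inj₂ _) = ⊤′
  preD (Bξ∧φ c _ _ _)         (inj₁ e) = preD c e
  preD (Bξ∧φ {ξ = ξ} _ _ _ _) (inj₂ _) = ξ
  preD (c ∧′ _ ⟨ _ ⟩)         (inj₁ e) = preD c e
  preD (_ ∧′ c′ ⟨ _ ⟩)        (inj₂ e) = preD c′ e

  preᵠ : {dφ : DBI φ} {nφ : Normal dφ} (c : Events nφ) → ∃ (Eᵠ c) → Formula
  preᵠ c (_ , inj₁ _)        = ⊤′
  preᵠ c (_ , inj₂ (inj₁ _)) = ⊤′
  preᵠ c (_ , inj₂ (inj₂ e)) = preD c e

  infix 9 _↾_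
  _↾_ : Pred (ℤ × ℤ) 0ℓ → Pred ℤ 0ℓ → Pred (ℤ × ℤ) 0ℓ
  Q′ ↾ E′ = Q′ ∩ (E′ ∖ ｛ 0ℤ ｝ ⟨×⟩ E′ ∖ ｛ 0ℤ ｝)

  -- The common step for B i ψ and B i (ξ ∧ ψ), which differ only in the
  -- precondition of the new event m.
  extend : (i : Agent) (m : ℤ) (E′ : Pred ℤ 0ℓ) (Q′ : Agent → Pred (ℤ × ℤ) 0ℓ) →
           Agent → Pred (ℤ × ℤ) 0ℓ
  extend i m E′ Q′ j =
    if does (j ≟ i)
    then Q′ j ↾ E′ ∪ ｛ (0ℤ , m) ｝ ∪ ｛ (m , m) ｝
    else Q′ j ↾ E′ ∪ ｛ (0ℤ , -1ℤ) ｝ ∪ (λ (a , k) → a ≡ m × (0ℤ , k) ∈ Q′ j)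

  Qᵠ : {dφ : DBI φ} {nφ : Normal dφ} → Events nφ → Agent → Pred (ℤ × ℤ) 0ℓ
  Qᵠ (Bξ {i = i} m _) j =
    if does (j ≟ i)
    then ｛ (0ℤ , m) ｝ ∪ ｛ (m , m) ｝ ∪ ｛ (-1ℤ , -1ℤ) ｝
    else ｛ (0ℤ , -1ℤ) ｝ ∪ ｛ (m , -1ℤ) ｝ ∪ ｛ (-1ℤ , -1ℤ) ｝
  Qᵠ (Bφ {i = i} c m _ _)   = extend i m (Eᵠ c) (Qᵠ c)
  Qᵠ (Bξ∧φ {i = i} c m _ _) = extend i m (Eᵠ c) (Qᵠ c)
  Qᵠ (c ∧′ c′ ⟨ _ ⟩) j =
      Qᵠ c j ↾ Eᵠ c
    ∪ Qᵠ c′ j ↾ Eᵠ c′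
    ∪ (λ (a , k) → a ≡ 0ℤ × k ∈ K)
    ∪ (λ e → e ≡ (0ℤ , -1ℤ) × ¬ ∃ K)
    where
    K : Pred ℤ 0ℓ
    K k = (0ℤ , k) ∈ (Qᵠ c j ∪ Qᵠ c′ j) × k ∈ D c ∪ D c′

  𝒰 : {dφ : DBI φ} {nφ : Normal dφ} → Events nφ → ActionModel
  𝒰 c = record
    { E        = ∃ (Eᵠ c)
    ; nonempty = 0ℤ , inj₁ refl
    ; Q        = λ { j (a , _) (b , _) → (a , b) ∈ Qᵠ c j }
    ; pre      = preᵠ c
    }

  event0 : {dφ : DBI φ} {nφ : Normal dφ} (c : Events nφ) → E (𝒰 c)
  event0 c = 0ℤ , inj₁ refl

  data ModalitySequence : Formula → List Agent → Set where
    []  : ∀ {θ} → ModalitySequence θ []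
    ¬′_ : ∀ {θ is} → ModalitySequence θ is → ModalitySequence (¬′ θ) is
    ∧ˡ  : ∀ {θ η is} → ModalitySequence θ is → ModalitySequence (θ ∧′ η) is
    ∧ʳ  : ∀ {θ η is} → ModalitySequence η is → ModalitySequence (θ ∧′ η) is
    B   : ∀ {θ i is} → ModalitySequence θ is → ModalitySequence (B i θ) (i ∷ is)

  data Run (U : ActionModel) : E U → List Agent → List (E U) → Set where
    []  : ∀ {α} → Run U α [] (α ∷ [])
    _∷_ : ∀ {α β i is αs} → Q U i α β → Run U β is αs → Run U α (i ∷ is) (α ∷ αs)

  -- Since successors in 𝒰 c exist and are unique, each sequence has exactly one run.
  ⊤-Shape : (U : ActionModel) → E U → Formula → Set
  ⊤-Shape U α₀ θ =
    ∀ {is} → ModalitySequence θ is →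
    ∀ {αs} → Run U α₀ is αs → All (λ α → pre U α ≡ ⊤′) αs

  Independent : {dφ : DBI φ} {nφ : Normal dφ} → Formula → Events nφ → Set
  Independent θ c = ⊤-Shape (𝒰 c) (event0 c) θ

{-# OPTIONS --safe #-}
-- Every event of 𝒰 c has a successor for every agent, so along each modality
-- sequence of θ the update neither removes a needed world (the preconditions
-- met there are ⊤′) nor a needed arrow. Hence θ is evaluated alike before and
-- after the update, by induction on θ at all worlds (x , α) with θ in
-- ⊤-shape with respect to α.
module Submission where

open import Defs
open import Data.Empty using (⊥-elim)
open import Data.Fin.Properties using (_≟_)
open import Data.Integer.Base using (ℤ; 0ℤ; 1ℤ; -1ℤ; _≤_; +≤+)
import Data.Irrelevant as Irrelevant
import Data.List.Relation.Unary.All as All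
open import Data.Nat.Base using (ℕ; _<_)
open import Data.Product.Base as Product using (∃; _×_; _,_; proj₁; proj₂)
open import Data.Refinement using (value; proof)
open import Data.Sum.Base as Sum using (_⊎_; inj₁; inj₂; [_,_]′)
open import Function.Base using (_∘_)
open import Function.Bundles using (_⇔_; mk⇔; module Equivalence)
open import Function.Properties.Equivalence using () renaming (refl to ⇔-refl)
open import Level using (Level; 0ℓ)
open import Relation.Binary.PropositionalEquality
  using (_≡_; _≢_; refl; sym; subst)
open import Relation.Nullary using (yes; no)
open import Relation.Unary using (Pred; _∈_; ｛_｝; _∪_)

module _ {n : ℕ} {Atom : Set} {p₀ : Atom} where

  open DEL n Atom p₀
  open KripkeModel using (S)
  open ActionModel using (E; Q; pre)

  private variable
    ℓ : Level
    φ : Formula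
    dφ : DBI φ
    nφ : Normal dφ

  Serial : ActionModel → Set
  Serial U = ∀ i α → ∃ λ β → Q U i α β

  -- Putting the arrow from `α` to `β` in front of a run for `θ` gives a run for `B i θ`; the tail
  -- of what is known about the longer run is what is wanted.
  ⊤-Shape-step : ∀ {U α β i θ} → ⊤-Shape U α (B i θ) → Q U i α β → ⊤-Shape U β θ
  ⊤-Shape-step shape αQβ μ run = All.tail (shape (B μ) (αQβ ∷ run))

  module _ (M : KripkeModel ℓ) (U : ActionModel) (serial : Serial U)
           (w : S M) (α : E U) (w⊨pre : M , w ⊨ pre U α) where

    open Update M U w α w⊨pre

    ⊤-Shape⇒⇔ : ∀ θ (s : World) → ⊤-Shape U (proj₂ (value s)) θ →
                (M , proj₁ (value s) ⊨ θ) ⇔ (model , s ⊨ θ)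
    ⊤-Shape⇒⇔ (atom p) s shape = ⇔-refl
    ⊤-Shape⇒⇔ (¬′ θ) s shape = mk⇔ (_∘ from) (_∘ to)
      where open Equivalence (⊤-Shape⇒⇔ θ s (shape ∘ ¬′_))
    ⊤-Shape⇒⇔ (θ ∧′ η) s shape =
      mk⇔ (Product.map (to ihθ) (to ihη)) (Product.map (from ihθ) (from ihη))
      where
      open Equivalence
      ihθ = ⊤-Shape⇒⇔ θ s (shape ∘ ∧ˡ)
      ihη = ⊤-Shape⇒⇔ η s (shape ∘ ∧ʳ)
    ⊤-Shape⇒⇔ (B i θ) s shape = mk⇔
      (λ Bθ t (xRu , βQγ) →
        to (⊤-Shape⇒⇔ θ t (⊤-Shape-step shape βQγ)) (Bθ (proj₁ (value t)) xRu))
      backward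
      where
      open Equivalence
      backward : model , s ⊨ B i θ → M , proj₁ (value s) ⊨ B i θ
      -- The world `u` must occur in the update; seriality supplies the event to pair it with.
      backward Bθ u xRu with serial i (proj₂ (value s))
      ... | γ , βQγ = from (⊤-Shape⇒⇔ θ t shapeγ) (Bθ t (xRu , βQγ))
        where
        shapeγ : ⊤-Shape U γ θ
        shapeγ = ⊤-Shape-step shape βQγ
        -- The empty modality sequence has the run consisting of `γ` alone, so `pre U γ` is `⊤′` and
        -- the pair `(u , γ)` survives.
        u⊨pre : M , u ⊨ pre U γ
        u⊨pre = subst (M , u ⊨_) (sym (All.head (shapeγ [] []))) (⊨⊤′ M u)
        t : World
        t = record
          { value = u , γ
          ; proof = Irrelevant.map (λ s∈ → step s∈ u⊨pre xRu βQγ) (proof s)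
          }

  1≤⇒≢0 : ∀ {m} → 1ℤ ≤ m → m ≢ 0ℤ
  1≤⇒≢0 (+≤+ ()) refl

  D-positive : (c : Events nφ) → ∀ {e} → e ∈ D c → 1ℤ ≤ e
  D-positive (Bξ m 1≤m)       refl        = 1≤m
  D-positive (Bφ c m 1≤m _)   (inj₁ e)    = D-positive c e
  D-positive (Bφ c m 1≤m _)   (inj₂ refl) = 1≤m
  D-positive (Bξ∧φ c m 1≤m _) (inj₁ e)    = D-positive c e
  D-positive (Bξ∧φ c m 1≤m _) (inj₂ refl) = 1≤m
  D-positive (c ∧′ c′ ⟨ _ ⟩)  (inj₁ e)    = D-positive c e
  D-positive (c ∧′ c′ ⟨ _ ⟩)  (inj₂ e)    = D-positive c′ e

  D≢0 : (c : Events nφ) → ∀ {e} → e ∈ D c → e ≢ 0ℤ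
  D≢0 c = 1≤⇒≢0 ∘ D-positive c

  D≢-1 : (c : Events nφ) → ∀ {e} → e ∈ D c → e ≢ -1ℤ
  D≢-1 c e∈ refl with D-positive c e∈
  ... | ()

  -- The alternative is decided by the syntax of φ, which is what makes the
  -- clause "no such k exists" of Qᵠ for conjunctions constructively usable.
  RootSuccessor : Pred ℤ 0ℓ → Pred (ℤ × ℤ) 0ℓ → Set
  RootSuccessor D′ Q′ =
    (∃ λ k → k ∈ D′ × (0ℤ , k) ∈ Q′) ⊎
    ((0ℤ , -1ℤ) ∈ Q′ × (∀ k → (0ℤ , k) ∈ Q′ → k ≡ -1ℤ))

  -- Agent `i` moves from the root to `m`. For any other agent only `(0ℤ , -1ℤ)` starts at the root:
  -- `↾` strips the old root arrows, and the arrows copied from the root start at `m`, which is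
  -- positive.
  rootSuccessor-extend : ∀ i m (D′ E′ : Pred ℤ 0ℓ) Q′ j → 1ℤ ≤ m →
                         RootSuccessor (D′ ∪ ｛ m ｝) (extend i m E′ Q′ j)
  rootSuccessor-extend i m D′ E′ Q′ j 1≤m with j ≟ i
  ... | yes _ = inj₁ (m , inj₂ refl , inj₂ (inj₁ refl))
  ... | no _  = inj₂ (inj₂ (inj₁ refl) , λ where
    k (inj₁ (_ , (_ , 0≢0) , _)) → ⊥-elim (0≢0 refl)
    k (inj₂ (inj₁ refl))         → refl
    k (inj₂ (inj₂ (0≡m , _)))    → ⊥-elim (1≤⇒≢0 1≤m (sym 0≡m)))

  rootSuccessor : (c : Events nφ) → ∀ j → RootSuccessor (D c) (Qᵠ c j)
  rootSuccessor (Bξ {i = i} m _) j with j ≟ i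
  ... | yes _ = inj₁ (m , refl , inj₁ refl)
  ... | no _  = inj₂ (inj₁ refl , λ where
    k (inj₁ refl)        → refl
    k (inj₂ (inj₁ refl)) → refl
    k (inj₂ (inj₂ ())))
  rootSuccessor (Bφ {i = i} c m 1≤m _) j =
    rootSuccessor-extend i m (D c) (Eᵠ c) (Qᵠ c) j 1≤m
  rootSuccessor (Bξ∧φ {i = i} c m 1≤m _) j =
    rootSuccessor-extend i m (D c) (Eᵠ c) (Qᵠ c) j 1≤m
  rootSuccessor (c ∧′ c′ ⟨ _ ⟩) j with rootSuccessor c j | rootSuccessor c′ j
  ... | inj₁ (k , k∈ , q) | _ =
    inj₁ (k , inj₁ k∈ , inj₂ (inj₂ (inj₁ (refl , inj₁ q , inj₁ k∈))))
  ... | inj₂ _ | inj₁ (k , k∈ , q) =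
    inj₁ (k , inj₂ k∈ , inj₂ (inj₂ (inj₁ (refl , inj₂ q , inj₂ k∈))))
  -- All root arrows of both conjuncts end in `-1ℤ`, which is not positive, so `K` is empty and the
  -- default arrow to `-1ℤ` is present.
  ... | inj₂ (_ , unique) | inj₂ (_ , unique′) =
    inj₂ ( inj₂ (inj₂ (inj₂ (refl , λ (k , q , k∈) →
             [ D≢-1 c , D≢-1 c′ ]′ k∈ (≡-1 q))))
         , λ where
             k (inj₁ (_ , (_ , 0≢0) , _))        → ⊥-elim (0≢0 refl)
             k (inj₂ (inj₁ (_ , (_ , 0≢0) , _))) → ⊥-elim (0≢0 refl)
             k (inj₂ (inj₂ (inj₁ (_ , q , _))))  → ≡-1 q
             k (inj₂ (inj₂ (inj₂ (refl , _))))   → refl)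
    where
    ≡-1 : ∀ {k} → (0ℤ , k) ∈ (Qᵠ c j ∪ Qᵠ c′ j) → k ≡ -1ℤ
    ≡-1 = [ unique _ , unique′ _ ]′

  NonRoot : Pred ℤ 0ℓ → Pred ℤ 0ℓ
  NonRoot D′ = ｛ -1ℤ ｝ ∪ D′

  -- The target is kept away from `0ℤ` so that the arrow outlives the restriction `↾` when the
  -- formula is built up further.
  NonRootSuccessor : Pred ℤ 0ℓ → Pred (ℤ × ℤ) 0ℓ → Pred ℤ 0ℓ
  NonRootSuccessor D′ Q′ a = ∃ λ b → b ∈ NonRoot D′ × (a , b) ∈ Q′

  RootSuccessor⇒NonRootSuccessor : ∀ D′ Q′ →
    RootSuccessor D′ Q′ → NonRootSuccessor D′ Q′ 0ℤ
  RootSuccessor⇒NonRootSuccessor D′ Q′ (inj₁ (k , k∈ , q)) = k , inj₂ k∈ , q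
  RootSuccessor⇒NonRootSuccessor D′ Q′ (inj₂ (q , _))      = -1ℤ , inj₁ refl , q

  NonRoot≢0 : (c : Events nφ) → ∀ {a} → a ∈ NonRoot (D c) → a ≢ 0ℤ
  NonRoot≢0 c (inj₁ refl) ()
  NonRoot≢0 c (inj₂ a∈)   = D≢0 c a∈

  ↾-intro : (c : Events nφ) → ∀ {j a b} → a ∈ NonRoot (D c) → b ∈ NonRoot (D c) →
            (a , b) ∈ Qᵠ c j → (a , b) ∈ Qᵠ c j ↾ Eᵠ c
  ↾-intro c a∈ b∈ q =
    q , (inj₂ a∈ , NonRoot≢0 c a∈ ∘ sym) , (inj₂ b∈ , NonRoot≢0 c b∈ ∘ sym)

  -- Old events keep their arrows. The new event `m` loops for agent `i` and copies the arrows of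
  -- the old root for the others, hence the appeal to `rootSuccessor`.
  successor-extend : (c : Events nφ) → ∀ i m j →
    (∀ {a} → a ∈ NonRoot (D c) → NonRootSuccessor (D c) (Qᵠ c j) a) →
    ∀ {a} → a ∈ NonRoot (D c ∪ ｛ m ｝) →
    NonRootSuccessor (D c ∪ ｛ m ｝) (extend i m (Eᵠ c) (Qᵠ c) j) a
  successor-extend c i m j succ = λ where
      (inj₁ a≡-1)        → old (inj₁ a≡-1)
      (inj₂ (inj₁ a∈))   → old (inj₂ a∈)
      (inj₂ (inj₂ refl)) → new
    where
    D⁺ : Pred ℤ 0ℓ
    D⁺ = D c ∪ ｛ m ｝
    old : ∀ {a} → a ∈ NonRoot (D c) →
          NonRootSuccessor D⁺ (extend i m (Eᵠ c) (Qᵠ c) j) a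
    -- Both branches agree; the split on `j ≟ i` only lets `extend` compute.
    old a∈ with succ a∈ | j ≟ i
    ... | b , b∈ , q | yes _ = b , Sum.map₂ inj₁ b∈ , inj₁ (↾-intro c a∈ b∈ q)
    ... | b , b∈ , q | no _  = b , Sum.map₂ inj₁ b∈ , inj₁ (↾-intro c a∈ b∈ q)
    new : NonRootSuccessor D⁺ (extend i m (Eᵠ c) (Qᵠ c) j) m
    new with RootSuccessor⇒NonRootSuccessor (D c) (Qᵠ c j) (rootSuccessor c j) | j ≟ i
    ... | _          | yes _ = m , inj₂ (inj₂ refl) , inj₂ (inj₂ refl)
    ... | k , k∈ , q | no _  = k , Sum.map₂ inj₁ k∈ , inj₂ (inj₂ (refl , q))

  successor : (c : Events nφ) → ∀ j {a} → a ∈ NonRoot (D c) →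
              NonRootSuccessor (D c) (Qᵠ c j) a
  successor (Bξ {i = i} m _) j a∈ with j ≟ i | a∈
  ... | yes _ | inj₁ refl = -1ℤ , inj₁ refl , inj₂ (inj₂ refl)
  ... | yes _ | inj₂ refl = m , inj₂ refl , inj₂ (inj₁ refl)
  ... | no _  | inj₁ refl = -1ℤ , inj₁ refl , inj₂ (inj₂ refl)
  ... | no _  | inj₂ refl = -1ℤ , inj₁ refl , inj₂ (inj₁ refl)
  successor (Bφ {i = i} c m _ _)   j = successor-extend c i m j (successor c j)
  successor (Bξ∧φ {i = i} c m _ _) j = successor-extend c i m j (successor c j)
  successor (_∧′_⟨_⟩ {dis = dis} c c′ c⊥c′) j = λ where
      -- The event `-1ℤ` is shared by both conjuncts; the left one provides its successor.
      (inj₁ a≡-1)      → left (inj₁ a≡-1)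
      (inj₂ (inj₁ a∈)) → left (inj₂ a∈)
      (inj₂ (inj₂ a∈)) → right (inj₂ a∈)
    where
    Goal : Pred ℤ 0ℓ
    Goal = NonRootSuccessor (D c ∪ D c′) (Qᵠ (_∧′_⟨_⟩ {dis = dis} c c′ c⊥c′) j)
    left : ∀ {a} → a ∈ NonRoot (D c) → Goal a
    left a∈ with successor c j a∈
    ... | b , b∈ , q = b , Sum.map₂ inj₁ b∈ , inj₁ (↾-intro c a∈ b∈ q)
    right : ∀ {a} → a ∈ NonRoot (D c′) → Goal a
    right a∈ with successor c′ j a∈
    ... | b , b∈ , q = b , Sum.map₂ inj₂ b∈ , inj₂ (inj₁ (↾-intro c′ a∈ b∈ q))

  -- The root is treated apart because every construction redraws its arrows, while the other events
  -- inherit theirs.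
  𝒰-serial : (c : Events nφ) → Serial (𝒰 c)
  𝒰-serial c j (a , a∈) = let b , b∈ , q = succ a∈ in (b , inj₂ b∈) , q
    where
    succ : ∀ {a} → a ∈ Eᵠ c → NonRootSuccessor (D c) (Qᵠ c j) a
    succ (inj₁ refl) =
      RootSuccessor⇒NonRootSuccessor (D c) (Qᵠ c j) (rootSuccessor c j)
    succ (inj₂ a∈)   = successor c j a∈

theorem5 : (n : ℕ) → 1 < n → (Atom : Set) (p₀ : Atom) →
    let open DEL n Atom p₀ in
    {φ : Formula} {dφ : DBI φ} {nφ : Normal dφ} (c : Events nφ) →
    (θ : Formula) → Independent θ c →
    {ℓ : Level} (M : KripkeModel ℓ) (v : KripkeModel.S M) →
    let module M⊙𝒰 = Update M (𝒰 c) v (event0 c) (⊨⊤′ M v) in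
    (M , v ⊨ θ) ⇔ (M⊙𝒰.model , M⊙𝒰.origin ⊨ θ)
theorem5 n _ Atom p₀ c θ indep M v =
  ⊤-Shape⇒⇔ M (𝒰 c) (𝒰-serial c) v (event0 c) (⊨⊤′ M v) θ origin indep
  where
  open DEL n Atom p₀
  open Update M (𝒰 c) v (event0 c) (⊨⊤′ M v) using (origin)
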